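{- Let $G,H$ be finite groups with non-empty inverse-closed generating sets $S\subseteq G\setminus\{1\}$ and $T\subseteq H\setminus\{1\}$ respectively, let $\mathbb{F}$ be a finite field, and let $A\le\mathbb{F}^S$, $B\le\mathbb{F}^T$ be linear codes. Let $n=|G|$, $n'=|H|$, $\ell=|S|$, $\ell'=|T|$, and suppose that the Cayley codes $\mathbf{C}(G,S,A)$ and $\mathbf{C}(H,T,B)$ have ranks $k,k'$ and distances $d,d'$, respectively. Then the Cayley code $\mathbf{C}(G\times H,\,S\,\dot\cup\,T,\,A\oplus B)$, where $S,T$ are identified with $S\times 1$, $1\times T\subseteq G\times H$, has length $nn'(\ell+\ell')/2$, rank $kn'+k'n$, distance $\min\{d,d'\}$, rate $2(kn'+k'n)/(nn'(\ell+\ell'))$, and relative distance $2\min\{d,d'\}/(nn'(\ell+\ell'))$.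
   Context: For a finite set $X$, $\mathbb{F}^X$ is the $\mathbb{F}$-vector space of functions $f:X\to\mathbb{F}$. A linear code is a subspace $C\le\mathbb{F}^X$; its length is $|X|$, its rank is $\dim C$, its rate is $\dim(C)/|X|$, its distance is the minimum Hamming weight (number of non-zero entries) of a non-zero element of $C$ (defined for non-zero codes), and its relative distance is its distance divided by $|X|$. For disjoint sets $X,Y$, $\mathbb{F}^{X\dot\cup Y}=\mathbb{F}^X\oplus\mathbb{F}^Y$, so $A\oplus B\le\mathbb{F}^{S\dot\cup T}$. For a finite group $G$ and a non-empty inverse-closed subset $S\subseteq G\setminus\{1\}$, the Cayley graph $\mathrm{Cay}(G,S)$ has vertex set $G$ and edge set $E=\{\{g,sg\}\mid g\in G,\ s\in S\}$. For a linear code $B\le\mathbb{F}^S$, the Cayley code is $$\mathbf{C}(G,S,B)=\{f\in\mathbb{F}^E\mid \text{for all } g\in G, \text{ the function } S\to\mathbb{F},\ s\mapsto f(\{g,sg\}), \text{ lies in } B\}.$$ -}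

module Defs where

open import Level using (Level; _⊔_; suc)
open import Algebra.Bundles using (CommutativeRing; Group)
open import Algebra.Apartness.Bundles using (HeytingCommutativeRing; HeytingField)
import Algebra.Properties.CommutativeMonoid.Sum as Summation
import Algebra.Construct.DirectProduct as DirectProduct
open import Data.Empty using (⊥-elim)
open import Data.Fin.Base using (Fin)
open import Data.Integer.Base using (+_)
open import Data.Nat.Base using (ℕ; NonZero; _≤_)
open import Data.Product.Base using (Σ; Σ-syntax; ∃; ∃-syntax; _×_; _,_; proj₁; proj₂; swap)
open import Data.Product.Relation.Binary.Pointwise.NonDependent using (_×ₛ_)
open import Data.Rational.Base using (ℚ; _/_)
open import Data.Sum.Base using (_⊎_; inj₁; inj₂)
open import Data.Sum.Function.Setoid using (inj₁ₛ; inj₂ₛ)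
open import Data.Sum.Relation.Binary.Pointwise using (_⊎ₛ_; inj₁; inj₂)
open import Function.Bundles using (Func; Inverse; _⟨$⟩_)
import Function.Construct.Composition as Composition
import Function.Relation.Binary.Setoid.Equality as FuncEquality
open import Relation.Binary.Bundles using (Setoid)
import Relation.Binary.Construct.On as On
open import Relation.Binary.Definitions using (_Respects_)
open import Relation.Binary.PropositionalEquality using (_≡_)
import Relation.Binary.PropositionalEquality.Properties as ≡
open import Relation.Nullary.Negation using (¬_)
open import Relation.Unary using (Pred)

private
  variable
    a b c p q r ℓ ℓ₁ ℓ₂ : Level

HasCardinality : Setoid a ℓ → ℕ → Set (a ⊔ ℓ)
HasCardinality X n = Inverse X (≡.setoid (Fin n))

IsFinite : Setoid a ℓ → Set (a ⊔ ℓ)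
IsFinite X = ∃[ n ] HasCardinality X n

Elements : (X : Setoid a ℓ) → Pred (Setoid.Carrier X) p → Setoid (a ⊔ p) ℓ
Elements X P = On.setoid X (proj₁ {B = P})

-- Sets {x, y} with x, y ∈ X.
UnorderedPairs : Setoid a ℓ → Setoid a ℓ
UnorderedPairs X = record
  { Carrier       = Carrier × Carrier
  ; _≈_           = λ u v → u ≈² v ⊎ u ≈² swap v
  ; isEquivalence = record
    { refl  = inj₁ (refl , refl)
    ; sym   = λ where
        (inj₁ (e , e′)) → inj₁ (sym e , sym e′)
        (inj₂ (e , e′)) → inj₂ (sym e′ , sym e)
    ; trans = λ where
        (inj₁ (e , e′)) (inj₁ (d , d′)) → inj₁ (trans e d , trans e′ d′)
        (inj₁ (e , e′)) (inj₂ (d , d′)) → inj₂ (trans e d , trans e′ d′)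
        (inj₂ (e , e′)) (inj₁ (d , d′)) → inj₂ (trans e d′ , trans e′ d)
        (inj₂ (e , e′)) (inj₂ (d , d′)) → inj₁ (trans e d′ , trans e′ d)
    }
  }
  where
  open Setoid X
  open Setoid (X ×ₛ X) using () renaming (_≈_ to _≈²_)

-- Finite fields are HeytingFields with finite carrier: finiteness makes ≈ and
-- invertibility decidable, so by tightness x - y is invertible iff ¬ x ≈ y. The
-- zero ring is excluded by irreflexivity of #.
_^_ : HeytingField c ℓ₁ ℓ₂ → Setoid a ℓ → Set (a ⊔ ℓ ⊔ c ⊔ ℓ₁)
F ^ X = Func X (HeytingField.setoid F)

module _ (F : HeytingField c ℓ₁ ℓ₂) where

  open HeytingField F
  open CommutativeRing (HeytingCommutativeRing.commutativeRing heytingCommutativeRing)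
    using (+-commutativeMonoid)
  open Summation +-commutativeMonoid using (sum; sum-cong-≋)

  module Pointwise (X : Setoid a ℓ) where

    open FuncEquality X setoid public using () renaming (_≈_ to _≈ᶠ_)

    0ᶠ : F ^ X
    0ᶠ = record { to = λ _ → 0# ; cong = λ _ → refl }

    _+ᶠ_ : F ^ X → F ^ X → F ^ X
    f +ᶠ g = record
      { to   = λ x → (f ⟨$⟩ x) + (g ⟨$⟩ x)
      ; cong = λ e → +-cong (Func.cong f e) (Func.cong g e)
      }

    _*ᶠ_ : Carrier → F ^ X → F ^ X
    α *ᶠ f = record
      { to   = λ x → α * (f ⟨$⟩ x)
      ; cong = λ e → *-congˡ (Func.cong f e)
      }

    sumᶠ : ∀ {k} → (Fin k → Carrier) → (Fin k → F ^ X) → F ^ X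
    sumᶠ cs fs = record
      { to   = λ x → sum (λ i → cs i * (fs i ⟨$⟩ x))
      ; cong = λ e → sum-cong-≋ (λ i → *-congˡ (Func.cong (fs i) e))
      }

  record LinearCode (X : Setoid a ℓ) (p : Level) : Set (a ⊔ ℓ ⊔ c ⊔ ℓ₁ ⊔ suc p) where
    open Pointwise X
    field
      Member   : Pred (F ^ X) p
      resp     : Member Respects _≈ᶠ_
      0-mem    : Member 0ᶠ
      +-closed : ∀ {f g} → Member f → Member g → Member (f +ᶠ g)
      *-closed : ∀ α {f} → Member f → Member (α *ᶠ f)

module _ {F : HeytingField c ℓ₁ ℓ₂} {X : Setoid a ℓ} where

  open HeytingField F using (Carrier; _≈_; 0#)
  open Pointwise F X

  record IsBasis (C : LinearCode F X p) {k : ℕ} (b : Fin k → F ^ X)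
         : Set (a ⊔ ℓ ⊔ c ⊔ ℓ₁ ⊔ p) where
    open LinearCode C
    field
      members     : ∀ i → Member (b i)
      independent : ∀ cs → sumᶠ cs b ≈ᶠ 0ᶠ → ∀ i → cs i ≈ 0#
      spanning    : ∀ f → Member f → ∃[ cs ] f ≈ᶠ sumᶠ cs b

  HasWeight : F ^ X → ℕ → Set (a ⊔ ℓ ⊔ ℓ₁)
  HasWeight f w = HasCardinality (Elements X (λ x → ¬ ((f ⟨$⟩ x) ≈ 0#))) w

  HasLength : LinearCode F X p → ℕ → Set (a ⊔ ℓ)
  HasLength _ N = HasCardinality X N

  HasRank : LinearCode F X p → ℕ → Set (a ⊔ ℓ ⊔ c ⊔ ℓ₁ ⊔ p)
  HasRank C k = ∃[ b ] IsBasis C {k} b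

  record HasDistance (C : LinearCode F X p) (d : ℕ) : Set (a ⊔ ℓ ⊔ c ⊔ ℓ₁ ⊔ p) where
    open LinearCode C
    field
      attained : ∃[ f ] Member f × ¬ (f ≈ᶠ 0ᶠ) × HasWeight f d
      minimal  : ∀ f → Member f → ¬ (f ≈ᶠ 0ᶠ) → ∀ w → HasWeight f w → d ≤ w

  HasRate : LinearCode F X p → ℚ → Set (a ⊔ ℓ ⊔ c ⊔ ℓ₁ ⊔ p)
  HasRate C ρ = ∃[ k ] ∃[ N ] HasRank C k × HasLength C N ×
                (Σ[ nz ∈ NonZero N ] ρ ≡ _/_ (+ k) N {{nz}})

  HasRelativeDistance : LinearCode F X p → ℚ → Set (a ⊔ ℓ ⊔ c ⊔ ℓ₁ ⊔ p)
  HasRelativeDistance C δ = ∃[ d ] ∃[ N ] HasDistance C d × HasLength C N ×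
                            (Σ[ nz ∈ NonZero N ] δ ≡ _/_ (+ d) N {{nz}})

-- The identification of F ^ (X ⊎ₛ Y) with F ^ X ⊕ F ^ Y sends f to the pair of
-- its restrictions to X and Y.
_⊕_ : {F : HeytingField c ℓ₁ ℓ₂} {X : Setoid a ℓ} {Y : Setoid b r} →
      LinearCode F X p → LinearCode F Y q → LinearCode F (X ⊎ₛ Y) (p ⊔ q)
_⊕_ {X = X} {Y = Y} A B = record
  { Member   = λ f → A.Member (Composition.function inj₁ₛ f) ×
                     B.Member (Composition.function inj₂ₛ f)
  ; resp     = λ f≈g (m , n) → A.resp (λ x → f≈g (inj₁ x)) m ,
                               B.resp (λ y → f≈g (inj₂ y)) n
  ; 0-mem    = A.0-mem , B.0-mem
  ; +-closed = λ (m , n) (m′ , n′) → A.+-closed m m′ , B.+-closed n n′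
  ; *-closed = λ α (m , n) → A.*-closed α m , B.*-closed α n
  }
  where
  module A = LinearCode A
  module B = LinearCode B

-- The same code with its coordinates renamed along a bijection.
relabel : {F : HeytingField c ℓ₁ ℓ₂} {X : Setoid a ℓ} {Y : Setoid b r} →
          Inverse X Y → LinearCode F X p → LinearCode F Y p
relabel φ C = record
  { Member   = λ f → C.Member (Composition.function to f)
  ; resp     = λ f≈g → C.resp (λ x → f≈g (Inverse.to φ x))
  ; 0-mem    = C.0-mem
  ; +-closed = λ m n → C.+-closed m n
  ; *-closed = λ α m → C.*-closed α m
  }
  where
  module C = LinearCode C
  to = record { to = Inverse.to φ ; cong = Inverse.to-cong φ }

module _ (G : Group a ℓ) (S : Pred (Group.Carrier G) p) where

  open Group G using (Carrier; _≈_; _∙_; ε; _⁻¹; setoid; refl; ∙-congʳ)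

  -- The subgroup generated by S.
  data Generated : Pred Carrier (a ⊔ ℓ ⊔ p) where
    generator : ∀ {x} → S x → Generated x
    identity  : Generated ε
    product   : ∀ {x y} → Generated x → Generated y → Generated (x ∙ y)
    inverse   : ∀ {x} → Generated x → Generated (x ⁻¹)
    respects  : ∀ {x y} → x ≈ y → Generated x → Generated y

  record IsCayleyGeneratingSet : Set (a ⊔ ℓ ⊔ p) where
    field
      resp          : S Respects _≈_
      nonEmpty      : ∃ S
      ε∉            : ¬ S ε
      inverseClosed : ∀ {x} → S x → S (x ⁻¹)
      generates     : ∀ x → Generated x

  -- The set of unordered pairs { {g, sg} | g ∈ G, s ∈ S }, as the image of G × S:
  -- (g , s) and (g′ , s′) are the same edge iff {g, sg} = {g′, s′g′}.
  CayleyEdges : Setoid (a ⊔ p) ℓ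
  CayleyEdges = On.setoid {B = Carrier × Σ Carrier S} (UnorderedPairs setoid)
                  (λ (g , s , _) → (g , s ∙ g))

  module _ {F : HeytingField c ℓ₁ ℓ₂} where

    localView : F ^ CayleyEdges → Carrier → F ^ Elements setoid S
    localView f g = record
      { to   = λ s → f ⟨$⟩ (g , s)
      ; cong = λ s≈s′ → Func.cong f (inj₁ (refl , ∙-congʳ s≈s′))
      }

    CayleyCode : LinearCode F (Elements setoid S) q → LinearCode F CayleyEdges (a ⊔ q)
    CayleyCode B = record
      { Member   = λ f → ∀ g → B.Member (localView f g)
      ; resp     = λ f≈f′ m g → B.resp (λ s → f≈f′ (g , s)) (m g)
      ; 0-mem    = λ g → B.0-mem
      ; +-closed = λ m m′ g → B.+-closed (m g) (m′ g)
      ; *-closed = λ α m g → B.*-closed α (m g)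
      }
      where module B = LinearCode B

_×ᴳ_ : Group a ℓ₁ → Group b ℓ₂ → Group (a ⊔ b) (ℓ₁ ⊔ ℓ₂)
_×ᴳ_ = DirectProduct.group

module _ (G : Group a ℓ₁) (H : Group b ℓ₂) where

  private
    module G = Group G
    module H = Group H

  -- The subset (S × 1) ∪ (1 × T) of G × H.
  Union : Pred G.Carrier p → Pred H.Carrier q → Pred (G.Carrier × H.Carrier) (ℓ₁ ⊔ ℓ₂ ⊔ p ⊔ q)
  Union S T (g , h) = (S g × h H.≈ H.ε) ⊎ (g G.≈ G.ε × T h)

  identification :
    {S : Pred G.Carrier p} {T : Pred H.Carrier q} →
    IsCayleyGeneratingSet G S → IsCayleyGeneratingSet H T →
    Inverse (Elements G.setoid S ⊎ₛ Elements H.setoid T)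
            (Elements (Group.setoid (G ×ᴳ H)) (Union S T))
  identification {S = S} {T = T} genS genT = record
    { to        = to
    ; from      = from
    ; to-cong   = λ {x} {y} → to-cong x y
    ; from-cong = λ {u} {v} → from-cong u v
    ; inverse   = (λ {u} {v} e → to-from u v e) , (λ {x} {u} e → from-to x u e)
    }
    where
    module S = IsCayleyGeneratingSet genS
    module T = IsCayleyGeneratingSet genT
    X = Elements G.setoid S ⊎ₛ Elements H.setoid T
    Y = Elements (Group.setoid (G ×ᴳ H)) (Union S T)
    module X = Setoid X
    module Y = Setoid Y

    to : X.Carrier → Y.Carrier
    to (inj₁ (s , s∈S)) = (s , H.ε) , inj₁ (s∈S , H.refl)
    to (inj₂ (t , t∈T)) = (G.ε , t) , inj₂ (G.refl , t∈T)

    from : Y.Carrier → X.Carrier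
    from ((g , h) , inj₁ (g∈S , _)) = inj₁ (g , g∈S)
    from ((g , h) , inj₂ (_ , h∈T)) = inj₂ (h , h∈T)

    to-cong : ∀ x y → x X.≈ y → to x Y.≈ to y
    to-cong _ _ (inj₁ e) = e , H.refl
    to-cong _ _ (inj₂ e) = G.refl , e

    from-cong : ∀ u v → u Y.≈ v → from u X.≈ from v
    from-cong (_ , inj₁ _) (_ , inj₁ _) (e , _) = inj₁ e
    from-cong (_ , inj₂ _) (_ , inj₂ _) (_ , e) = inj₂ e
    from-cong (_ , inj₁ (g∈S , _)) (_ , inj₂ (g′≈ε , _)) (e , _) =
      ⊥-elim (S.ε∉ (S.resp (G.trans e g′≈ε) g∈S))
    from-cong (_ , inj₂ (g≈ε , _)) (_ , inj₁ (g′∈S , _)) (e , _) =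
      ⊥-elim (S.ε∉ (S.resp (G.trans (G.sym e) g≈ε) g′∈S))

    to∘from : ∀ u → to (from u) Y.≈ u
    to∘from (_ , inj₁ (_ , h≈ε)) = G.refl , H.sym h≈ε
    to∘from (_ , inj₂ (g≈ε , _)) = G.sym g≈ε , H.refl

    from∘to : ∀ x → from (to x) X.≈ x
    from∘to (inj₁ _) = inj₁ G.refl
    from∘to (inj₂ _) = inj₂ H.refl

    to-from : ∀ u x → x X.≈ from u → to x Y.≈ u
    to-from u x e = Y.trans {to x} {to (from u)} {u} (to-cong x (from u) e) (to∘from u)

    from-to : ∀ x u → u Y.≈ to x → from u X.≈ x
    from-to x u e = X.trans {from u} {from (to x)} {x} (from-cong u (to x) e) (from∘to x)

{-# OPTIONS --safe #-}
-- An edge of Cay(G × H, S ∪ T) is a G-edge times a point of H or an H-edge times a point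
-- of G. Along this decomposition the Cayley code of G × H is the direct sum of |H| copies
-- of C(G,S,A) and |G| copies of C(H,T,B), so bases concatenate and a non-zero codeword is
-- non-zero on one of the copies. Orienting the edges by an enumeration of the group gives
-- 2|E| = |G||S|.
module Submission where

open import Defs
open import Level using (Level)
open import Algebra.Bundles using (Group)
open import Algebra.Apartness.Bundles using (HeytingField)
open import Data.Integer.Base using (+_)
open import Data.Nat.Base using (ℕ; NonZero; _+_; _*_; _⊓_)
open import Data.Nat.Divisibility.Core using (_∣_)
import Data.Nat.DivMod as ℕ
import Data.Rational.Base as ℚ
open import Data.Product.Base using (Σ-syntax; _×_)
open import Relation.Unary using (Pred)

open import Algebra.Apartness.Bundles using (HeytingCommutativeRing)
open import Algebra.Bundles using (CommutativeMonoid; CommutativeRing)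
import Algebra.Properties.CommutativeMonoid.Sum as Summation
import Algebra.Properties.Group as GroupProperties
open import Data.Bool.Base using (Bool; not; if_then_else_)
import Data.Bool.Properties as Bool
open import Data.Fin.Base using (Fin; zero; suc; _↑ˡ_; _↑ʳ_; splitAt; combine; remQuot)
import Data.Fin.Properties as Fin
import Data.Fin.Permutation as Permutation
import Data.Integer.Properties as ℤ
open import Data.List.Base using (List; []; _∷_; [_]; length; lookup; deduplicate; allFin; concatMap; tabulate)
open import Data.List.Membership.Propositional.Properties using (∈-allFin; ∈-lookup)
import Data.List.Membership.Setoid.Properties as Membership
import Data.List.Relation.Unary.All as All
open import Data.List.Relation.Unary.AllPairs using (_∷_)
open import Data.List.Relation.Unary.Any using (here)
import Data.List.Relation.Unary.Any as Any
import Data.List.Relation.Unary.Any.Properties as Any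
open import Data.List.Relation.Unary.Enumerates.Setoid using (IsEnumeration)
import Data.List.Relation.Unary.Enumerates.Setoid.Properties as Enumerates
open import Data.List.Relation.Unary.Unique.Setoid using (Unique)
import Data.List.Relation.Unary.Unique.DecSetoid.Properties as Unique
import Data.Nat.Base as ℕ
open import Data.Nat.Divisibility.Core using (divides)
import Data.Nat.Properties as ℕ
open import Data.Nat.Tactic.RingSolver using (solve-∀)
open import Data.Product.Base using (∃-syntax; Σ; _,_; proj₁; proj₂)
open import Data.Product.Function.NonDependent.Setoid using (_×-inverse_)
open import Data.Product.Relation.Binary.Pointwise.NonDependent as Product using (_×ₛ_)
import Data.Rational.Properties as ℚ
import Data.Rational.Unnormalised.Base as ℚᵘ
open import Data.Sum.Base using (_⊎_; inj₁; inj₂; [_,_]′)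
open import Data.Sum.Function.Setoid using (_⊎-inverse_)
open import Data.Sum.Relation.Binary.Pointwise as Sum using (_⊎ₛ_; inj₁; inj₂)
open import Function.Base using (_∘_; id)
open import Function.Bundles using (Func; Inverse; Injection; _⟨$⟩_; _⇔_; mk⇔; Equivalence)
import Function.Consequences.Setoid as Consequences
import Function.Construct.Composition as Composition
import Function.Construct.Symmetry as Symmetry
open import Function.Definitions using (Injective)
open import Function.Properties.Bijection using (Bijection⇒Inverse)
open import Function.Properties.Inverse using (Inverse⇒Injection; toFunction; fromFunction)
open import Relation.Binary.Bundles using (Setoid; DecSetoid)
open import Relation.Binary.Definitions using (Decidable; _Respects_; tri<; tri≈; tri>)
open import Relation.Binary.PropositionalEquality as ≡ using (_≡_; _≢_; cong; cong₂; subst)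
open import Relation.Nullary.Decidable using (yes; no; does; _×-dec_; _⊎-dec_; via-injection; decidable-stable; ¬?; dec-true; dec-false)
open import Relation.Nullary.Negation using (¬_; contradiction)
import Relation.Unary as Unary

private
  variable
    a b c p q r₁ r₂ ℓ ℓ₁ ℓ₂ ℓ₃ : Level
    m n k d w : ℕ
    X Y Z : Setoid a ℓ

-- Finite setoids

_⁻¹ⁱ : Inverse X Y → Inverse Y X
_⁻¹ⁱ = Symmetry.inverse

infixr 9 _⨾_

_⨾_ : Inverse X Y → Inverse Y Z → Inverse X Z
_⨾_ = Composition.inverse

-- The inverse map is read off from the constructive surjectivity proof, and injectivity makes it
-- respect equality, so later bijections need only these two checks.
func⇒inverse : (f : Func X Y) →
               Injective (Setoid._≈_ X) (Setoid._≈_ Y) (Func.to f) →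
               (∀ y → ∃[ x ] Setoid._≈_ Y (f ⟨$⟩ x) y) →
               Inverse X Y
func⇒inverse {X = X} {Y = Y} f injective surjective = Bijection⇒Inverse record
  { to        = Func.to f
  ; cong      = Func.cong f
  ; bijective = injective , Consequences.strictlySurjective⇒surjective X Y (Func.cong f) surjective
  }

×-cardinality : HasCardinality X m → HasCardinality Y n → HasCardinality (X ×ₛ Y) (m * n)
×-cardinality cX cY = (cX ×-inverse cY) ⨾ Product.Pointwise-≡↔≡ ⨾ Fin.*↔× ⁻¹ⁱ

⊎-cardinality : HasCardinality X m → HasCardinality Y n → HasCardinality (X ⊎ₛ Y) (m + n)
⊎-cardinality cX cY = (cX ⊎-inverse cY) ⨾ Sum.Pointwise-≡↔≡ _ _ ⨾ Fin.+↔⊎ ⁻¹ⁱ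

cardinality-unique : HasCardinality X m → HasCardinality X n → m ≡ n
cardinality-unique cX cX′ = Permutation.↔⇒≡ (cX ⁻¹ⁱ ⨾ cX′)

cardinality-nonZero : HasCardinality X n → Setoid.Carrier X → NonZero n
cardinality-nonZero cX x = Fin.nonZeroIndex (Inverse.to cX x)

cardinality-mono : HasCardinality X m → HasCardinality Y n → Injection X Y → m ℕ.≤ n
cardinality-mono cX cY i = Fin.injective⇒≤ {f = Injection.to j} (Injection.injective j)
  where j = Composition.injection (Inverse⇒Injection (cX ⁻¹ⁱ)) (Composition.injection i (Inverse⇒Injection cY))

cardinality⇒≈? : HasCardinality X n → Decidable (Setoid._≈_ X)
cardinality⇒≈? cX = via-injection (Inverse⇒Injection cX) Fin._≟_

lookup-injective : (X : Setoid a ℓ) → ∀ {xs} → Unique X xs →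
                   Injective _≡_ (Setoid._≈_ X) (lookup xs)
lookup-injective X (_ ∷ _) {zero} {zero} _ = ≡.refl
lookup-injective X {_ ∷ xs} (x≉ ∷ _) {zero} {suc j} e = contradiction e (All.lookup x≉ (∈-lookup j))
lookup-injective X {_ ∷ xs} (x≉ ∷ _) {suc i} {zero} e = contradiction (Setoid.sym X e) (All.lookup x≉ (∈-lookup i))
lookup-injective X (_ ∷ xs!) {suc i} {suc j} e = cong suc (lookup-injective X xs! e)

-- Once repetitions up to `≈` are removed, lookup by position is injective as well as surjective,
-- and the length of the remaining list is the cardinality.
enumeration⇒finite : Decidable (Setoid._≈_ X) → ∀ xs → IsEnumeration X xs → IsFinite X
enumeration⇒finite {X = X} _≟_ xs enum = length ys , func⇒inverse at (lookup-injective X ys!) surj ⁻¹ⁱ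
  where
  X? : DecSetoid _ _
  X? = record { isDecEquivalence = record { isEquivalence = Setoid.isEquivalence X ; _≟_ = _≟_ } }
  ys = deduplicate _≟_ xs
  ys! = Unique.deduplicate-! X? xs
  at = record { to = lookup ys ; cong = λ { ≡.refl → Setoid.refl X } }
  surj : ∀ x → ∃[ i ] Setoid._≈_ X (lookup ys i) x
  surj x with Enumerates.lookup-surjective X (Enumerates.deduplicate⁺ X? enum) x
  ... | i , e = i , e ≡.refl

-- Meant for quotients such as an edge set: the size stays existential here and is pinned down later
-- by counting the same set in two ways.
image-finite : HasCardinality X n → Decidable (Setoid._≈_ Y) → (f : Func X Y) →
               (∀ y → ∃[ x ] Setoid._≈_ Y (f ⟨$⟩ x) y) → IsFinite Y
image-finite {X = X} {Y = Y} cX _≟_ f surjective =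
  enumeration⇒finite _≟_ (tabulate (λ i → f ⟨$⟩ from i)) λ y → let (x , fx≈y) = surjective y in
    Membership.∈-resp-≈ Y (Y.trans (Func.cong f (strictlyInverseʳ x)) fx≈y) (Membership.∈-tabulate⁺ Y (to x))
  where
  open Inverse cX
  module Y = Setoid Y

-- Equality in `Elements X P` ignores the proof of `P`, so listing one witness for each point that
-- satisfies `P` already enumerates the subset.
Elements-finite : HasCardinality X n → {P : Pred (Setoid.Carrier X) p} →
                  P Respects (Setoid._≈_ X) → Unary.Decidable P → IsFinite (Elements X P)
Elements-finite {X = X} cX {P} resp P? =
  enumeration⇒finite (λ (x , _) (y , _) → cardinality⇒≈? cX x y) (concatMap fibre (allFin _)) enum
  where
  open Inverse cX
  module X = Setoid X
  P-setoid = Elements X P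

  fibre : Fin _ → List (Σ X.Carrier P)
  fibre i with P? (from i)
  ... | yes px = [ from i , px ]
  ... | no _   = []

  ∈-fibre : ∀ y i → i ≡ to (proj₁ y) → Any.Any (Setoid._≈_ P-setoid y) (fibre i)
  ∈-fibre (x , px) i ≡.refl with P? (from i)
  ... | yes _  = here (X.sym (strictlyInverseʳ x))
  ... | no ¬px = contradiction (resp (X.sym (strictlyInverseʳ x)) px) ¬px

  enum : IsEnumeration P-setoid (concatMap fibre (allFin _))
  enum y = Any.concatMap⁺ fibre (Any.map (λ { ≡.refl → ∈-fibre y _ ≡.refl }) (∈-allFin (to (proj₁ y))))

-- Finite sums

module _ (M : CommutativeMonoid c ℓ) where

  open CommutativeMonoid M
  open Summation M

  sum-++ : ∀ m {n} (f : Fin (m + n) → Carrier) →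
           sum f ≈ sum (λ i → f (i ↑ˡ n)) ∙ sum (λ j → f (m ↑ʳ j))
  sum-++ ℕ.zero    f = sym (identityˡ _)
  sum-++ (ℕ.suc m) f = trans (∙-congˡ (sum-++ m (f ∘ suc))) (sym (assoc _ _ _))

  sum-combine : ∀ m {n} (f : Fin (m * n) → Carrier) →
                sum f ≈ sum {m} (λ i → sum {n} (λ j → f (combine i j)))
  sum-combine ℕ.zero        f = refl
  sum-combine (ℕ.suc m) {n} f = trans (sum-++ n f) (∙-congˡ (sum-combine m (f ∘ (n ↑ʳ_))))

  sum-ε : (f : Fin n → Carrier) → (∀ i → f i ≈ ε) → sum f ≈ ε
  sum-ε {n} f f≈ε = trans (sum-cong-≋ f≈ε) (sum-replicate-zero n)

  sum-single : (f : Fin n → Carrier) (j : Fin n) → (∀ i → i ≢ j → f i ≈ ε) → sum f ≈ f j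
  sum-single {ℕ.suc n} f j f≈ε = trans (sum-remove {i = j} f)
    (trans (∙-congˡ (sum-ε _ λ i → f≈ε _ (Fin.punchInᵢ≢i j i))) (identityʳ _))

-- Linear codes

module _ {F : HeytingField c ℓ₁ ℓ₂} where

  open HeytingField F
    using (Carrier; _≈_; 0#; 1#; refl; sym; trans; *-congˡ; *-identityˡ; setoid)
    renaming (_*_ to _·_; _+_ to _∔_; +-cong to ∔-cong; +-identityˡ to ∔-identityˡ; +-identityʳ to ∔-identityʳ)
  open CommutativeRing (HeytingCommutativeRing.commutativeRing (HeytingField.heytingCommutativeRing F))
    using (+-commutativeMonoid; zeroˡ; zeroʳ; *-congʳ)
  open Summation +-commutativeMonoid using (sum; sum-cong-≋)

  -- Under these conditions `ι` restricts to a bijection of supports. Asking for preimages only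
  -- where `g` is non-zero covers extension by zero as well as relabelling along a bijection.
  weight-transport : (f : F ^ X) (g : F ^ Y) (ι : Injection X Y) →
    (∀ x → (g ⟨$⟩ Injection.to ι x) ≈ (f ⟨$⟩ x)) →
    (∀ y → ¬ ((g ⟨$⟩ y) ≈ 0#) → ∃[ x ] Setoid._≈_ Y (Injection.to ι x) y) →
    HasWeight {F = F} f w → HasWeight {F = F} g w
  weight-transport {X = X} {Y = Y} f g ι gι≈f onto wf = func⇒inverse on-supports ι.injective onto-support ⁻¹ⁱ ⨾ wf
    where
    module ι = Injection ι

    on-supports : Func (Elements X (λ x → ¬ ((f ⟨$⟩ x) ≈ 0#))) (Elements Y (λ y → ¬ ((g ⟨$⟩ y) ≈ 0#)))
    on-supports = record
      { to   = λ (x , fx≉0) → ι.to x , λ e → fx≉0 (trans (sym (gι≈f x)) e)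
      ; cong = ι.cong
      }

    onto-support : ∀ y → ∃[ x ] Setoid._≈_ (Elements Y (λ y → ¬ ((g ⟨$⟩ y) ≈ 0#))) (on-supports ⟨$⟩ x) y
    onto-support (y , gy≉0) with onto y gy≉0
    ... | x , ιx≈y = (x , λ fx≈0 → gy≉0 (trans (sym (Func.cong g ιx≈y)) (trans (gι≈f x) fx≈0))) , ιx≈y

  -- The restriction `f∘ι` is a non-zero codeword of `C`, so its weight is at least `d`, and its
  -- support injects into that of `f`.
  distance≤weight : Decidable _≈_ → HasCardinality X m → {C : LinearCode F X p} → HasDistance C d →
    (ι : Injection X Y) (f : F ^ Y) → let f∘ι = Composition.function (Injection.function ι) f in
    LinearCode.Member C f∘ι → ∀ x → ¬ ((f∘ι ⟨$⟩ x) ≈ 0#) → HasWeight {F = F} f w → d ℕ.≤ w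
  distance≤weight {X = X} {Y = Y} _≟_ cX dC ι f fι∈C x fιx≉0 wf =
    ℕ.≤-trans (minimal f∘ι fι∈C (λ fι≈0 → fιx≉0 (fι≈0 x)) w′ wfι) (cardinality-mono wfι wf on-supports)
    where
    open HasDistance dC
    module ι = Injection ι
    f∘ι = Composition.function ι.function f
    -- `minimal` speaks only of words with a given weight, so the weight of the restriction must
    -- first be shown to exist. Decidable equality in the field provides it.
    support-finite = Elements-finite cX {P = λ x → ¬ ((f∘ι ⟨$⟩ x) ≈ 0#)}
      (λ x≈y fx≉0 fy≈0 → fx≉0 (trans (Func.cong f∘ι x≈y) fy≈0)) (λ x → ¬? ((f∘ι ⟨$⟩ x) ≟ 0#))
    w′ = proj₁ support-finite
    wfι : HasWeight {F = F} f∘ι w′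
    wfι = proj₂ support-finite

    on-supports : Injection (Elements X (λ x → ¬ ((f∘ι ⟨$⟩ x) ≈ 0#))) (Elements Y (λ y → ¬ ((f ⟨$⟩ y) ≈ 0#)))
    on-supports = record
      { to        = λ (x , fx≉0) → ι.to x , fx≉0
      ; cong      = ι.cong
      ; injective = ι.injective
      }

  -- Transport of rank and distance along a bijection of coordinates

  module _ {C : LinearCode F X p} {D : LinearCode F Y q} (φ : Inverse X Y)
           (D⇔C : ∀ f → LinearCode.Member D f ⇔ LinearCode.Member (relabel φ C) f) where

    private
      module C = LinearCode C
      module φ = Inverse φ

      pull : F ^ Y → F ^ X
      pull = Composition.function (toFunction φ)

      push : F ^ X → F ^ Y
      push = Composition.function (fromFunction φ)

      push∈D : ∀ {f} → C.Member f → LinearCode.Member D (push f)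
      -- Pushing and then pulling back evaluates `f` at `φ.from (φ.to x)`, which is only `≈` to `x`;
      -- hence `C.resp`.
      push∈D {f} f∈C = Equivalence.from (D⇔C (push f)) (C.resp (λ x → Func.cong f (Setoid.sym X (φ.strictlyInverseʳ x))) f∈C)

    rank-transport : HasRank C k → HasRank D k
    rank-transport (b , isBasis) = (λ i → push (b i)) , record
      { members     = λ i → push∈D (members i)
      ; independent = λ cs Σ≈0 → independent cs λ x →
          -- The combination of pushed vectors at `φ.to x` is by computation the combination of `b`
          -- at `φ.from (φ.to x)`.
          trans (Func.cong (Pointwise.sumᶠ F X cs b) (Setoid.sym X (φ.strictlyInverseʳ x))) (Σ≈0 (φ.to x))
      ; spanning    = λ f f∈D → let (cs , f≈) = spanning (pull f) (Equivalence.to (D⇔C f) f∈D) in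
          cs , λ y → trans (Func.cong f (Setoid.sym Y (φ.strictlyInverseˡ y))) (f≈ (φ.from y))
      }
      where open IsBasis isBasis

    distance-transport : HasDistance C d → HasDistance D d
    distance-transport dC = record
      { attained = let (f , f∈C , f≉0 , wf) = attained in
          push f , push∈D f∈C ,
          (λ push≈0 → f≉0 λ x → trans (Func.cong f (Setoid.sym X (φ.strictlyInverseʳ x))) (push≈0 (φ.to x))) ,
          weight-transport f (push f) (Inverse⇒Injection φ) (λ x → Func.cong f (φ.strictlyInverseʳ x))
            (λ y _ → φ.from y , φ.strictlyInverseˡ y) wf
      ; minimal  = λ f f∈D f≉0 w wf → minimal (pull f) (Equivalence.to (D⇔C f) f∈D)
          (λ pull≈0 → f≉0 λ y → trans (Func.cong f (Setoid.sym Y (φ.strictlyInverseˡ y))) (pull≈0 (φ.from y))) w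
          (weight-transport f (pull f) (Inverse⇒Injection (φ ⁻¹ⁱ)) (λ y → Func.cong f (φ.strictlyInverseˡ y))
            (λ x _ → φ.to x , φ.strictlyInverseʳ x) wf)
      }
      where open HasDistance dC

  -- Direct sum of two codes

  module _ (A : LinearCode F X p) (B : LinearCode F Y q) where

    private
      module A = LinearCode A
      module B = LinearCode B
      open module X⊎Y = Pointwise F (X ⊎ₛ Y) using (sumᶠ; _≈ᶠ_)

      extendˡ : F ^ X → F ^ (X ⊎ₛ Y)
      extendˡ f = record
        { to   = [ f ⟨$⟩_ , (λ _ → 0#) ]′
        ; cong = λ { (inj₁ e) → Func.cong f e ; (inj₂ _) → refl }
        }

      extendʳ : F ^ Y → F ^ (X ⊎ₛ Y)
      extendʳ f = record
        { to   = [ (λ _ → 0#) , f ⟨$⟩_ ]′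
        ; cong = λ { (inj₁ _) → refl ; (inj₂ e) → Func.cong f e }
        }

      extendˡ-member : ∀ {f} → A.Member f → LinearCode.Member (A ⊕ B) (extendˡ f)
      extendˡ-member f∈A = A.resp (λ _ → refl) f∈A , B.resp (λ _ → refl) B.0-mem

      extendʳ-member : ∀ {f} → B.Member f → LinearCode.Member (A ⊕ B) (extendʳ f)
      extendʳ-member f∈B = A.resp (λ _ → refl) A.0-mem , B.resp (λ _ → refl) f∈B

    -- The two bases, extended by zero, are concatenated. Restricting a combination to one summand
    -- kills the other block, so independence and spanning are checked on each summand separately.
    ⊕-rank : HasRank A m → HasRank B n → HasRank (A ⊕ B) (m + n)
    ⊕-rank {m} {n} (bA , isBasisA) (bB , isBasisB) = basis , record
      { members     = members
      ; independent = independent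
      ; spanning    = spanning
      }
      where
      module bA = IsBasis isBasisA
      module bB = IsBasis isBasisB

      vector : Fin m ⊎ Fin n → F ^ (X ⊎ₛ Y)
      vector = [ extendˡ ∘ bA , extendʳ ∘ bB ]′

      basis : Fin (m + n) → F ^ (X ⊎ₛ Y)
      basis = vector ∘ splitAt m

      members : ∀ i → LinearCode.Member (A ⊕ B) (basis i)
      members i with splitAt m i
      ... | inj₁ j = extendˡ-member (bA.members j)
      ... | inj₂ j = extendʳ-member (bB.members j)

      sum-split : ∀ cs z → (sumᶠ cs basis ⟨$⟩ z) ≈
        sum (λ i → cs (i ↑ˡ n) · (extendˡ (bA i) ⟨$⟩ z)) ∔ sum (λ j → cs (m ↑ʳ j) · (extendʳ (bB j) ⟨$⟩ z))
      sum-split cs z = trans (sum-++ +-commutativeMonoid m _) (∔-cong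
        (sum-cong-≋ λ i → HeytingField.reflexive F (cong (λ v → cs (i ↑ˡ n) · (vector v ⟨$⟩ z)) (Fin.splitAt-↑ˡ m i n)))
        (sum-cong-≋ λ j → HeytingField.reflexive F (cong (λ v → cs (m ↑ʳ j) · (vector v ⟨$⟩ z)) (Fin.splitAt-↑ʳ m n j))))

      sum-inj₁ : ∀ cs x → (sumᶠ cs basis ⟨$⟩ inj₁ x) ≈ (Pointwise.sumᶠ F X (λ i → cs (i ↑ˡ n)) bA ⟨$⟩ x)
      sum-inj₁ cs x = trans (sum-split cs (inj₁ x))
        (trans (∔-cong refl (sum-ε +-commutativeMonoid {n = n} _ λ j → zeroʳ _)) (∔-identityʳ _))

      sum-inj₂ : ∀ cs y → (sumᶠ cs basis ⟨$⟩ inj₂ y) ≈ (Pointwise.sumᶠ F Y (λ j → cs (m ↑ʳ j)) bB ⟨$⟩ y)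
      sum-inj₂ cs y = trans (sum-split cs (inj₂ y))
        (trans (∔-cong (sum-ε +-commutativeMonoid {n = m} _ λ i → zeroʳ _) refl) (∔-identityˡ _))

      independent : ∀ cs → sumᶠ cs basis ≈ᶠ X⊎Y.0ᶠ → ∀ i → cs i ≈ 0#
      independent cs Σ≈0 i with splitAt m i | Fin.join-splitAt m n i
      -- Matching on `join-splitAt` turns `i` into `j ↑ˡ n`, so that `cs i` is a coefficient of the
      -- first block.
      ... | inj₁ j | ≡.refl = bA.independent _ (λ x → trans (sym (sum-inj₁ cs x)) (Σ≈0 (inj₁ x))) j
      ... | inj₂ j | ≡.refl = bB.independent _ (λ y → trans (sym (sum-inj₂ cs y)) (Σ≈0 (inj₂ y))) j

      spanning : ∀ f → LinearCode.Member (A ⊕ B) f → ∃[ cs ] f ≈ᶠ sumᶠ cs basis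
      spanning f (f∈A , f∈B) with bA.spanning _ f∈A | bB.spanning _ f∈B
      ... | csA , f≈A | csB , f≈B = cs , λ where
          (inj₁ x) → trans (f≈A x) (trans (sum-cong-≋ λ i → *-congʳ (HeytingField.reflexive F
            (≡.sym (cong [ csA , csB ]′ (Fin.splitAt-↑ˡ m i n))))) (sym (sum-inj₁ cs x)))
          (inj₂ y) → trans (f≈B y) (trans (sum-cong-≋ λ j → *-congʳ (HeytingField.reflexive F
            (≡.sym (cong [ csA , csB ]′ (Fin.splitAt-↑ʳ m n j))))) (sym (sum-inj₂ cs y)))
        where cs = [ csA , csB ]′ ∘ splitAt m

    -- The minimum is attained by extending a minimal word of the code with the smaller distance by
    -- zero. For the bound, a non-zero word has a non-zero entry in `X` or in `Y`, and
    -- `distance≤weight` applies on that side.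
    ⊕-distance : Decidable _≈_ → HasCardinality X m → HasCardinality Y n →
                 HasDistance A d → HasDistance B k → HasDistance (A ⊕ B) (d ⊓ k)
    ⊕-distance {d = d} {k = k} _≟_ cX cY dA dB = record { attained = attained ; minimal = minimal }
      where
      module dA = HasDistance dA
      module dB = HasDistance dB

      inj₁ⁱ : Injection X (X ⊎ₛ Y)
      inj₁ⁱ = record { to = inj₁ ; cong = inj₁ ; injective = λ { (inj₁ e) → e } }

      inj₂ⁱ : Injection Y (X ⊎ₛ Y)
      inj₂ⁱ = record { to = inj₂ ; cong = inj₂ ; injective = λ { (inj₂ e) → e } }

      attained : ∃[ f ] LinearCode.Member (A ⊕ B) f × ¬ (f ≈ᶠ X⊎Y.0ᶠ) × HasWeight {F = F} f (d ⊓ k)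
      attained with ℕ.⊓-sel d k | dA.attained | dB.attained
      ... | inj₁ d⊓k≡d | f , f∈A , f≉0 , wf | _ =
        extendˡ f , extendˡ-member f∈A , (λ e → f≉0 (e ∘ inj₁)) ,
        subst (HasWeight {F = F} (extendˡ f)) (≡.sym d⊓k≡d)
          (weight-transport f (extendˡ f) inj₁ⁱ (λ _ → refl)
            (λ { (inj₁ x) _ → x , Setoid.refl (X ⊎ₛ Y) {inj₁ x} ; (inj₂ _) 0≉0 → contradiction refl 0≉0 }) wf)
      ... | inj₂ d⊓k≡k | _ | f , f∈B , f≉0 , wf =
        extendʳ f , extendʳ-member f∈B , (λ e → f≉0 (e ∘ inj₂)) ,
        subst (HasWeight {F = F} (extendʳ f)) (≡.sym d⊓k≡k)
          (weight-transport f (extendʳ f) inj₂ⁱ (λ _ → refl)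
            (λ { (inj₁ _) 0≉0 → contradiction refl 0≉0 ; (inj₂ y) _ → y , Setoid.refl (X ⊎ₛ Y) {inj₂ y} }) wf)

      minimal : ∀ f → LinearCode.Member (A ⊕ B) f → ¬ (f ≈ᶠ X⊎Y.0ᶠ) → ∀ w → HasWeight {F = F} f w → d ⊓ k ℕ.≤ w
      -- The hypothesis `f≉0` exhibits no non-zero coordinate. Instead, a weight below the bound
      -- would force every coordinate to vanish; decidability of `≤` and of field equality justifies
      -- the two double-negation steps.
      minimal f (f∈A , f∈B) f≉0 w wf = decidable-stable (_ ℕ.≤? _) λ d⊓k≰w → f≉0 λ where
        (inj₁ x) → decidable-stable (_ ≟ _) λ fx≉0 → d⊓k≰w
          (ℕ.≤-trans (ℕ.m⊓n≤m d k) (distance≤weight _≟_ cX {C = A} dA inj₁ⁱ f (A.resp (λ _ → refl) f∈A) x fx≉0 wf))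
        (inj₂ y) → decidable-stable (_ ≟ _) λ fy≉0 → d⊓k≰w
          (ℕ.≤-trans (ℕ.m⊓n≤n d k) (distance≤weight _≟_ cY {C = B} dB inj₂ⁱ f (B.resp (λ _ → refl) f∈B) y fy≉0 wf))

  -- Copies of a code indexed by a set

  slice : F ^ (X ×ₛ Y) → Setoid.Carrier Y → F ^ X
  slice {Y = Y} f y = record
    { to   = λ x → f ⟨$⟩ (x , y)
    ; cong = λ e → Func.cong f (e , Setoid.refl Y)
    }

  -- For finite `Y` this is the tensor product of `C` with the full space `F ^ Y`. Stated slicewise
  -- rather than as an iterated `⊕`, it needs no enumeration of `Y` and has the same quantifier
  -- shape as a Cayley code.
  copies : LinearCode F X p → (Y : Setoid b ℓ) → LinearCode F (X ×ₛ Y) _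
  copies {X = X} C Y = record
    { Member   = λ f → ∀ y → C.Member (slice {X = X} {Y = Y} f y)
    ; resp     = λ f≈g f∈ y → C.resp (λ x → f≈g (x , y)) (f∈ y)
    ; 0-mem    = λ y → C.resp (λ _ → refl) C.0-mem
    ; +-closed = λ f∈ g∈ y → C.resp (λ _ → refl) (C.+-closed (f∈ y) (g∈ y))
    ; *-closed = λ α f∈ y → C.resp (λ _ → refl) (C.*-closed α (f∈ y))
    }
    where module C = LinearCode C

  module _ (C : LinearCode F X p) (cY : HasCardinality Y n) where

    private
      module C = LinearCode C
      module cY = Inverse cY
      open module X×Y = Pointwise F (X ×ₛ Y) using (sumᶠ; _≈ᶠ_)

      δ : Fin n → Setoid.Carrier Y → Carrier
      δ j y = if does (j Fin.≟ cY.to y) then 1# else 0#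

      δ≈1 : ∀ j y → j ≡ cY.to y → δ j y ≈ 1#
      δ≈1 j y e with j Fin.≟ cY.to y
      ... | yes _ = refl
      ... | no j≢ = contradiction e j≢

      δ≈0 : ∀ j y → j ≢ cY.to y → δ j y ≈ 0#
      δ≈0 j y j≢ with j Fin.≟ cY.to y
      ... | yes e = contradiction e j≢
      ... | no _  = refl

      -- The tensor of `f` with the unit vector of index `j`: `f` on that slice and zero on all
      -- others.
      extend : F ^ X → Fin n → F ^ (X ×ₛ Y)
      extend f j = record
        { to   = λ (x , y) → δ j y · (f ⟨$⟩ x)
        ; cong = λ { {_ , y} (ex , ey) → HeytingField.*-cong F
                   (HeytingField.reflexive F (cong (λ i → if does (j Fin.≟ i) then 1# else 0#) (cY.to-cong ey)))
                   (Func.cong f ex) }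
        }

      extend-member : ∀ {f} j → C.Member f → LinearCode.Member (copies C Y) (extend f j)
      extend-member j f∈C y = C.resp (λ _ → refl) (C.*-closed (δ j y) f∈C)

    copies-rank : HasRank C k → HasRank (copies C Y) (k * n)
    copies-rank {k} (b , isBasis) = bY , record
      { members     = λ l → extend-member (proj₂ (remQuot {k} n l)) (members _)
      ; independent = independentY
      ; spanning    = spanningY
      }
      where
      open IsBasis isBasis

      vector : Fin k × Fin n → F ^ (X ×ₛ Y)
      vector (i , j) = extend (b i) j

      bY : Fin (k * n) → F ^ (X ×ₛ Y)
      bY = vector ∘ remQuot n

      -- In the double sum over `i` and `j`, the factor `δ j y` leaves only the term with `j` the
      -- index of `y`. Independence and spanning thereby reduce to those of `b` on each slice.
      sum-slice : ∀ cs x y → (sumᶠ cs bY ⟨$⟩ (x , y)) ≈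
                             (Pointwise.sumᶠ F X (λ i → cs (combine i (cY.to y))) b ⟨$⟩ x)
      sum-slice cs x y = trans (sum-combine +-commutativeMonoid k _) (sum-cong-≋ λ i →
        trans (sum-cong-≋ λ j → HeytingField.reflexive F
                (cong (λ v → cs (combine i j) · (vector v ⟨$⟩ (x , y))) (Fin.remQuot-combine i j)))
        (trans (sum-single +-commutativeMonoid _ (cY.to y)
                 (λ j j≢ → trans (*-congˡ (trans (*-congʳ (δ≈0 j y j≢)) (zeroˡ _))) (zeroʳ _)))
               (*-congˡ (trans (*-congʳ (δ≈1 _ y ≡.refl)) (*-identityˡ _)))))

      independentY : ∀ cs → sumᶠ cs bY ≈ᶠ X×Y.0ᶠ → ∀ l → cs l ≈ 0#
      independentY cs Σ≈0 l with Fin.combine-surjective {k} {n} l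
      ... | i , j , ≡.refl = trans
        -- The slice at `cY.from j` has index `cY.to (cY.from j)`, which must be identified with
        -- `j`.
        (HeytingField.reflexive F (cong (cs ∘ combine i) (≡.sym (cY.strictlyInverseˡ j))))
        (independent _ (λ x → trans (sym (sum-slice cs x (cY.from j))) (Σ≈0 (x , cY.from j))) i)

      spanningY : ∀ f → LinearCode.Member (copies C Y) f → ∃[ cs ] f ≈ᶠ sumᶠ cs bY
      -- Coefficients are chosen once per index, at the representative `cY.from j`, so `f` is first
      -- moved from `y` to the representative `y′`.
      spanningY f f∈ = cs , λ (x , y) → let y′ = cY.from (cY.to y) in
        trans (Func.cong f (Setoid.refl X , Setoid.sym Y (cY.strictlyInverseʳ y)))
        (trans (proj₂ (spanning _ (f∈ y′)) x)
        (trans (sum-cong-≋ λ i → *-congʳ (HeytingField.reflexive F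
                 (≡.sym (cong coefficient (Fin.remQuot-combine i (cY.to y))))))
               (sym (sum-slice cs x y))))
        where
        coefficient : Fin k × Fin n → Carrier
        coefficient (i , j) = proj₁ (spanning _ (f∈ (cY.from j))) i
        cs = coefficient ∘ remQuot n

    -- A minimal word of `C` placed on the slice at `y₀` attains `d`; with `Y` empty there would be
    -- no non-zero word. The bound is the slicewise use of `distance≤weight`.
    copies-distance : Decidable _≈_ → HasCardinality X m → Setoid.Carrier Y →
                      HasDistance C d → HasDistance (copies C Y) d
    copies-distance {d = d} _≟_ cX y₀ dC = record
      { attained = let (f , f∈C , f≉0 , wf) = attained in
          extend f j₀ , extend-member j₀ f∈C , (λ e → f≉0 λ x → trans (sym (on-slice f x)) (e (x , y₀))) ,
          weight-transport f (extend f j₀) (at y₀) (on-slice f) (off-slice f) wf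
      ; minimal  = λ f f∈ f≉0 w wf → decidable-stable (_ ℕ.≤? _) λ d≰w → f≉0 λ (x , y) →
          decidable-stable (_ ≟ _) λ fxy≉0 → d≰w
            (distance≤weight _≟_ cX {C = C} dC (at y) f (C.resp (λ _ → refl) (f∈ y)) x fxy≉0 wf)
      }
      where
      open HasDistance dC
      j₀ = cY.to y₀

      at : Setoid.Carrier Y → Injection X (X ×ₛ Y)
      at y = record { to = _, y ; cong = _, Setoid.refl Y ; injective = proj₁ }

      on-slice : ∀ f x → (extend f j₀ ⟨$⟩ (x , y₀)) ≈ (f ⟨$⟩ x)
      on-slice f x = trans (*-congʳ (δ≈1 j₀ y₀ ≡.refl)) (*-identityˡ _)

      off-slice : ∀ f z → ¬ ((extend f j₀ ⟨$⟩ z) ≈ 0#) → ∃[ x ] Setoid._≈_ (X ×ₛ Y) (x , y₀) z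
      off-slice f (x , y) ≉0 with j₀ Fin.≟ cY.to y
      ... | yes e = x , Setoid.refl X , Injection.injective (Inverse⇒Injection cY) e
      ... | no _  = contradiction (zeroˡ _) ≉0

-- Cayley graphs

module _ {G : Group a ℓ} {S : Pred (Group.Carrier G) p} (genS : IsCayleyGeneratingSet G S) where

  open Group G
  open GroupProperties G using (identityˡ-unique; ∙-cancelʳ)
  open IsCayleyGeneratingSet genS
  private module E = Setoid (CayleyEdges G S)

  -- Cayley graphs have no loops, because `ε` is not in `S`. Both the edge count and the separation
  -- of the two kinds of product edges rest on this.
  translate≉ : ∀ {s} g → S s → ¬ (s ∙ g ≈ g)
  translate≉ {s} g s∈S sg≈g = ε∉ (resp (identityˡ-unique s g sg≈g) s∈S)

  -- A pair `(g , s)` is a directed edge, equivalently an undirected edge together with a bit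
  -- telling whether the index grows from `g` to `s ∙ g`. Writing the count as `e * 2` records that
  -- the product is even.
  CayleyEdges-cardinality : HasCardinality setoid m → HasCardinality (Elements setoid S) n →
                            ∃[ e ] HasCardinality (CayleyEdges G S) e × e * 2 ≡ m * n
  CayleyEdges-cardinality cG cS = e , cE ,
    cardinality-unique (×-cardinality cE (Fin.2↔Bool ⁻¹ⁱ)) (orientation ⁻¹ⁱ ⨾ ×-cardinality cG cS)
    where
    module cG = Inverse cG
    _≈?_ = cardinality⇒≈? cG
    GS = setoid ×ₛ Elements setoid S

    quotient : Func GS (CayleyEdges G S)
    quotient = record { to = id ; cong = λ (g≈ , s≈) → inj₁ (g≈ , ∙-cong s≈ g≈) }

    edges-finite : IsFinite (CayleyEdges G S)
    edges-finite = image-finite (×-cardinality cG cS)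
      (λ (g , s , _) (g′ , s′ , _) →
        ((g ≈? g′) ×-dec ((s ∙ g) ≈? (s′ ∙ g′))) ⊎-dec ((g ≈? (s′ ∙ g′)) ×-dec ((s ∙ g) ≈? g′)))
      quotient (λ x → x , E.refl {x})

    e = proj₁ edges-finite
    cE = proj₂ edges-finite

    ascending : Carrier → Carrier → Bool
    ascending x y = does (cG.to x Fin.<? cG.to y)

    ascending-cong : ∀ {x x′ y y′} → x ≈ x′ → y ≈ y′ → ascending x y ≡ ascending x′ y′
    ascending-cong x≈ y≈ = cong₂ (λ i j → does (i Fin.<? j)) (cG.to-cong x≈) (cG.to-cong y≈)

    ascending-flip : ∀ {x y} → ¬ (x ≈ y) → ascending x y ≡ not (ascending y x)
    ascending-flip {x} {y} x≉y with Fin.<-cmp (cG.to x) (cG.to y)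
    ... | tri< x<y _ y≮x = ≡.trans (dec-true (_ Fin.<? _) x<y) (cong not (≡.sym (dec-false (_ Fin.<? _) y≮x)))
    ... | tri≈ _ x≡y _   = contradiction (Injection.injective (Inverse⇒Injection cG) x≡y) x≉y
    ... | tri> x≮y _ y<x = ≡.trans (dec-false (_ Fin.<? _) x≮y) (cong not (≡.sym (dec-true (_ Fin.<? _) y<x)))

    orient : Func GS (CayleyEdges G S ×ₛ ≡.setoid Bool)
    orient = record
      { to   = λ x@(g , s , _) → x , ascending g (s ∙ g)
      ; cong = λ {x} {y} (g≈ , s≈) → Func.cong quotient {x} {y} (g≈ , s≈) , ascending-cong g≈ (∙-cong s≈ g≈)
      }

    orientation : Inverse GS (CayleyEdges G S ×ₛ ≡.setoid Bool)
    orientation = func⇒inverse orient (λ {x} {y} → injective x y) surjective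
      where
      injective : ∀ x y → Setoid._≈_ (CayleyEdges G S ×ₛ ≡.setoid Bool) (orient ⟨$⟩ x) (orient ⟨$⟩ y) → Setoid._≈_ GS x y
      injective (g , s , _) (g′ , s′ , _) (inj₁ (g≈g′ , sg≈s′g′) , _) =
        g≈g′ , ∙-cancelʳ g s s′ (trans sg≈s′g′ (∙-congˡ (sym g≈g′)))
      -- Two pairs running along one edge in opposite directions would carry opposite bits.
      injective (g , s , _) (g′ , s′ , s′∈S) (inj₂ (g≈s′g′ , sg≈g′) , same) =
        contradiction
          (≡.trans (≡.sym same) (≡.trans (ascending-cong g≈s′g′ sg≈g′) (ascending-flip (translate≉ g′ s′∈S))))
          (Bool.not-¬ ≡.refl)

      surjective : ∀ y → ∃[ x ] Setoid._≈_ (CayleyEdges G S ×ₛ ≡.setoid Bool) (orient ⟨$⟩ x) y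
      surjective (x@(g , s , s∈S) , o) with ascending g (s ∙ g) Bool.≟ o
      ... | yes e = x , E.refl {x} , e
      -- If the bit is wrong, the same edge is walked backwards, from `s ∙ g` by `s ⁻¹`.
      ... | no e≢ = (s ∙ g , s ⁻¹ , inverseClosed s∈S) , inj₂ (refl , back) ,
          ≡.trans (ascending-cong refl back)
            (≡.trans (ascending-flip (translate≉ g s∈S)) (≡.sym (Bool.¬-not (e≢ ∘ ≡.sym))))
        where
        back : s ⁻¹ ∙ (s ∙ g) ≈ g
        back = trans (sym (assoc _ _ _)) (trans (∙-congʳ (inverseˡ s)) (identityˡ g))

-- Edges and Cayley code of the product group

module _ {G : Group a ℓ₁} {H : Group b ℓ₂} {S : Pred (Group.Carrier G) p} {T : Pred (Group.Carrier H) q}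
         (genS : IsCayleyGeneratingSet G S) (genT : IsCayleyGeneratingSet H T) where

  private
    module G = Group G
    module H = Group H
    GH-edges = CayleyEdges (G ×ᴳ H) (Union G H S T)
    split-edges = (CayleyEdges G S ×ₛ H.setoid) ⊎ₛ (CayleyEdges H T ×ₛ G.setoid)
    module GH-edges = Setoid GH-edges

  product-edges : Inverse split-edges GH-edges
  product-edges = func⇒inverse (record { to = to ; cong = λ {x} {y} → to-cong x y })
                               (λ {x} {y} → injective x y) surjective
    where
    to : Setoid.Carrier split-edges → GH-edges.Carrier
    to (inj₁ ((g , s , s∈S) , h)) = (g , h) , (s , H.ε) , inj₁ (s∈S , H.refl)
    to (inj₂ ((h , t , t∈T) , g)) = (g , h) , (G.ε , t) , inj₂ (G.refl , t∈T)

    to-cong : ∀ x y → Setoid._≈_ split-edges x y → to x GH-edges.≈ to y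
    to-cong _ _ (inj₁ (inj₁ (g≈ , sg≈) , h≈)) = inj₁ ((g≈ , h≈) , (sg≈ , H.∙-congˡ h≈))
    -- For a reversed edge the constant coordinate `h` is compared with a product by `H.ε`, hence
    -- the identity laws.
    to-cong _ _ (inj₁ (inj₂ (g≈ , sg≈) , h≈)) =
      inj₂ ((g≈ , H.trans h≈ (H.sym (H.identityˡ _))) , (sg≈ , H.trans (H.identityˡ _) h≈))
    to-cong _ _ (inj₂ (inj₁ (h≈ , th≈) , g≈)) = inj₁ ((g≈ , h≈) , (G.∙-congˡ g≈ , th≈))
    to-cong _ _ (inj₂ (inj₂ (h≈ , th≈) , g≈)) =
      inj₂ ((G.trans g≈ (G.sym (G.identityˡ _)) , h≈) , (G.trans (G.identityˡ _) g≈ , th≈))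

    injective : ∀ x y → to x GH-edges.≈ to y → Setoid._≈_ split-edges x y
    injective (inj₁ _) (inj₁ _) (inj₁ ((g≈ , h≈) , (sg≈ , _))) = inj₁ (inj₁ (g≈ , sg≈) , h≈)
    injective (inj₁ _) (inj₁ _) (inj₂ ((g≈ , h≈) , (sg≈ , _))) =
      inj₁ (inj₂ (g≈ , sg≈) , H.trans h≈ (H.identityˡ _))
    injective (inj₂ _) (inj₂ _) (inj₁ ((g≈ , h≈) , (_ , th≈))) = inj₂ (inj₁ (h≈ , th≈) , g≈)
    injective (inj₂ _) (inj₂ _) (inj₂ ((g≈ , h≈) , (_ , th≈))) =
      inj₂ (inj₂ (h≈ , th≈) , G.trans g≈ (G.identityˡ _))
    -- An `S`-edge changes the `G`-coordinate while a `T`-edge keeps it, so an equality between them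
    -- would give a loop; the remaining mixed cases are analogous.
    injective (inj₁ ((g , s , s∈S) , _)) (inj₂ _) (inj₁ ((g≈ , _) , (sg≈ , _))) =
      contradiction (G.trans sg≈ (G.trans (G.identityˡ _) (G.sym g≈))) (translate≉ genS g s∈S)
    injective (inj₁ ((g , s , s∈S) , _)) (inj₂ _) (inj₂ ((g≈ , _) , (sg≈ , _))) =
      contradiction (G.trans sg≈ (G.sym (G.trans g≈ (G.identityˡ _)))) (translate≉ genS g s∈S)
    injective (inj₂ ((h , t , t∈T) , _)) (inj₁ _) (inj₁ ((_ , h≈) , (_ , th≈))) =
      contradiction (H.trans th≈ (H.trans (H.identityˡ _) (H.sym h≈))) (translate≉ genT h t∈T)
    injective (inj₂ ((h , t , t∈T) , _)) (inj₁ _) (inj₂ ((_ , h≈) , (_ , th≈))) =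
      contradiction (H.trans th≈ (H.sym (H.trans h≈ (H.identityˡ _)))) (translate≉ genT h t∈T)

    surjective : ∀ y → ∃[ x ] to x GH-edges.≈ y
    -- In `Union` the second component is only `≈` to the identity; `to` uses `H.ε` itself, and the
    -- edge is unchanged up to equality.
    surjective ((g , h) , (s , t) , inj₁ (s∈S , t≈ε)) =
      inj₁ ((g , s , s∈S) , h) , inj₁ ((G.refl , H.refl) , (G.refl , H.∙-congʳ (H.sym t≈ε)))
    surjective ((g , h) , (s , t) , inj₂ (s≈ε , t∈T)) =
      inj₂ ((h , t , t∈T) , g) , inj₁ ((G.refl , H.refl) , (G.∙-congʳ (G.sym s≈ε) , H.refl))

  -- The local view at `(g , h)`, restricted to `S`, is the local view at `g` of the slice at `h`,
  -- and symmetrically for `T`. Since `product-edges` and `identification` pick the same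
  -- representatives, the values agree by computation and only the quantifiers are rearranged.
  product-code⇔ : {F : HeytingField c ℓ ℓ₃} (A : LinearCode F (Elements G.setoid S) r₁)
    (B : LinearCode F (Elements H.setoid T) r₂) → ∀ f →
    LinearCode.Member (CayleyCode (G ×ᴳ H) (Union G H S T) (relabel (identification G H genS genT) (A ⊕ B))) f ⇔
    LinearCode.Member (relabel product-edges (copies (CayleyCode G S A) H.setoid ⊕ copies (CayleyCode H T B) G.setoid)) f
  product-code⇔ {F = F} A B f = mk⇔
    (λ f∈ → (λ h g → A.resp (λ _ → F.refl) (proj₁ (f∈ (g , h)))) , (λ g h → B.resp (λ _ → F.refl) (proj₂ (f∈ (g , h)))))
    (λ (f∈A , f∈B) (g , h) → A.resp (λ _ → F.refl) (f∈A h g) , B.resp (λ _ → F.refl) (f∈B g h))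
    where
    module A = LinearCode A
    module B = LinearCode B
    module F = HeytingField F

-- Rates are defined with the true length as denominator, which is half of the denominator in the
-- stated fractions; cross-multiplication reconciles the two.
double-quotient : ∀ K e D .{{_ : NonZero e}} .{{_ : NonZero D}} → e * 2 ≡ D →
                  + (2 * K) ℚ./ D ≡ + K ℚ./ e
-- Matching on `suc` exhibits both denominators as successors, the form in which `mkℚᵘ` stores them.
double-quotient K (ℕ.suc e) _ ≡.refl = ℚ.fromℚᵘ-cong {ℚᵘ.mkℚᵘ (+ (2 * K)) _} {ℚᵘ.mkℚᵘ (+ K) e}
  (ℚᵘ.*≡* (≡.trans (≡.sym (ℤ.pos-* (2 * K) (ℕ.suc e)))
          (≡.trans (cong +_ (double-cross K (ℕ.suc e))) (ℤ.pos-* K (ℕ.suc e * 2)))))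
  where
  double-cross : ∀ K e → 2 * K * e ≡ K * (e * 2)
  double-cross = solve-∀

mainTheorem5 : {a₁ a₂ b₁ b₂ c₁ c₂ c₃ s t p q : Level}
    (G : Group a₁ a₂) (H : Group b₁ b₂) (F : HeytingField c₁ c₂ c₃)
    (S : Pred (Group.Carrier G) s) (T : Pred (Group.Carrier H) t)
    (genS : IsCayleyGeneratingSet G S) (genT : IsCayleyGeneratingSet H T) →
    IsFinite (HeytingField.setoid F) →
    (A : LinearCode F (Elements (Group.setoid G) S) p)
    (B : LinearCode F (Elements (Group.setoid H) T) q)
    (n n′ ℓ ℓ′ k k′ d d′ : ℕ) →
    HasCardinality (Group.setoid G) n →
    HasCardinality (Group.setoid H) n′ →
    HasCardinality (Elements (Group.setoid G) S) ℓ →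
    HasCardinality (Elements (Group.setoid H) T) ℓ′ →
    HasRank (CayleyCode G S A) k →
    HasRank (CayleyCode H T B) k′ →
    HasDistance (CayleyCode G S A) d →
    HasDistance (CayleyCode H T B) d′ →
    let C = CayleyCode (G ×ᴳ H) (Union G H S T) (relabel (identification G H genS genT) (A ⊕ B))
        D = n * n′ * (ℓ + ℓ′)
    in
    (2 ∣ D × HasLength C (D ℕ./ 2)) ×
    HasRank C (k * n′ + k′ * n) ×
    HasDistance C (d ⊓ d′) ×
    (Σ[ nz ∈ NonZero D ]
      HasRate C (ℚ._/_ (+ (2 * (k * n′ + k′ * n))) D {{nz}}) ×
      HasRelativeDistance C (ℚ._/_ (+ (2 * (d ⊓ d′))) D {{nz}}))
mainTheorem5 G H F S T genS genT (_ , cF) A B n n′ ℓ ℓ′ k k′ d d′ cG cH cS cT rA rB dA dB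
  with CayleyEdges-cardinality genS cG cS | CayleyEdges-cardinality genT cH cT
... | e , cE , e*2≡nℓ | e′ , cE′ , e′*2≡n′ℓ′ =
  (divides N (≡.sym N*2≡D) , subst (HasCardinality _) (≡.sym D/2≡N) C-length) ,
  C-rank ,
  C-distance ,
  D≢0 ,
  (_ , N , C-rank , C-length , N≢0 , double-quotient (k * n′ + k′ * n) N D {{N≢0}} {{D≢0}} N*2≡D) ,
  (_ , N , C-distance , C-length , N≢0 , double-quotient (d ⊓ d′) N D {{N≢0}} {{D≢0}} N*2≡D)
  where
  module G = Group G
  module H = Group H
  CA = CayleyCode G S A
  CB = CayleyCode H T B
  C = CayleyCode (G ×ᴳ H) (Union G H S T) (relabel (identification G H genS genT) (A ⊕ B))
  D = n * n′ * (ℓ + ℓ′)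
  -- The actual number of edges: one copy of the `G`-edges for each point of `H` and one of the
  -- `H`-edges for each point of `G`.
  N = e * n′ + e′ * n
  φ = product-edges genS genT
  F≟ = cardinality⇒≈? cF

  C-length : HasLength C N
  C-length = φ ⁻¹ⁱ ⨾ ⊎-cardinality (×-cardinality cE cH) (×-cardinality cE′ cG)

  C-rank : HasRank C (k * n′ + k′ * n)
  C-rank = rank-transport φ (product-code⇔ genS genT A B)
    (⊕-rank (copies CA H.setoid) (copies CB G.setoid) (copies-rank CA cH rA) (copies-rank CB cG rB))

  C-distance : HasDistance C (d ⊓ d′)
  C-distance = distance-transport φ (product-code⇔ genS genT A B)
    (⊕-distance (copies CA H.setoid) (copies CB G.setoid) F≟ (×-cardinality cE cH) (×-cardinality cE′ cG)
      -- The identities serve as the points on whose copies the minimal words are placed.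
      (copies-distance CA cH F≟ cE H.ε dA) (copies-distance CB cG F≟ cE′ G.ε dB))

  N*2≡D : N * 2 ≡ D
  N*2≡D = ≡.trans (distribute e e′ n n′)
    (≡.trans (cong₂ (λ x y → x * n′ + y * n) e*2≡nℓ e′*2≡n′ℓ′) (collect n n′ ℓ ℓ′))
    where
    distribute : ∀ e e′ n n′ → (e * n′ + e′ * n) * 2 ≡ e * 2 * n′ + e′ * 2 * n
    distribute = solve-∀
    collect : ∀ n n′ ℓ ℓ′ → n * ℓ * n′ + n′ * ℓ′ * n ≡ n * n′ * (ℓ + ℓ′)
    collect = solve-∀

  D/2≡N : D ℕ./ 2 ≡ N
  D/2≡N = ≡.trans (cong (ℕ._/ 2) (≡.sym N*2≡D)) (ℕ.m*n/n≡m N 2)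

  N≢0 : NonZero N
  -- An edge exists because `S` is non-empty: an `S`-edge at `G.ε` over the point `H.ε`.
  N≢0 = cardinality-nonZero C-length
    (Inverse.to φ (inj₁ ((G.ε , IsCayleyGeneratingSet.nonEmpty genS) , H.ε)))

  D≢0 : NonZero D
  D≢0 = subst NonZero N*2≡D (ℕ.m*n≢0 N 2 {{N≢0}})
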